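{- Let $f$ be a positive integer-valued function on the positive integers satisfying $f(n)=o(n)$. If the Kneser graph $KG(n,f(n))$ has an $f(n)$-vertex subgraph $H$ with chromatic number at least $t$, then there is a $(3n+2f(n))$-vertex $K_3$-free graph $G$ with minimum degree at least $n=\frac{1}{3}|V(G)|-\frac{2}{3}f(n)$ and chromatic number at least $t$.
   Context: All graphs are finite and simple. For positive integers $n,k$, the Kneser graph $KG(n,k)$ has as vertex set the collection of all $n$-element subsets of $\{1,\dots,2n+k\}$, two vertices being adjacent if and only if the corresponding subsets are disjoint (often denoted $KG(2n+k,n)$). An $m$-vertex subgraph is a subgraph with exactly $m$ vertices.
   Formalization: The claim is proved for all sufficiently large n (threshold depending only on f); for every n it fails, e.g. n=1, f(1)=5, t=5: KG(1,5)=K_7 contains K_5, but no 13-vertex triangle-free graph has chromatic number 5. -}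

module Defs where

open import Level using (0ℓ)
open import Data.Bool using (Bool; T)
open import Data.Nat using (ℕ; _+_; _*_; _≤_; _≥_; NonZero; ≢-nonZero⁻¹)
open import Data.Integer using (+_)
open import Data.Rational as ℚ using (ℚ; 0ℚ)
open import Data.Fin using (Fin)
open import Data.Fin.Subset using (Subset; _∩_; ∣_∣; Empty)
open import Data.Fin.Subset.Properties using (Empty-unique; ∩-idem; ∩-comm; ∣⊥∣≡0; nonempty?)
open import Data.Product using (Σ; Σ-syntax; ∃; _×_; _,_; proj₁; proj₂)
open import Data.Vec using (tabulate)
open import Function.Bundles using (_↔_)
open import Relation.Binary using (Rel; Symmetric; Irreflexive; Decidable)
open import Relation.Binary.PropositionalEquality using (_≡_; _≢_; refl; sym; trans; cong; subst)
open import Relation.Nullary using (¬_; does)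
open import Relation.Nullary.Decidable using (¬?)
open import Relation.Unary using (Pred)

toℚ : ℕ → ℚ
toℚ n = (+ n) ℚ./ 1

-- Functions defined on the positive integers only.
ℕ⁺→ℕ : Set
ℕ⁺→ℕ = (n : ℕ) → .{{NonZero n}} → ℕ

-- f(n) = o(n).  Letting ε range over positive rationals rather than reals
-- gives the same notion.
IsLittleOh-n : ℕ⁺→ℕ → Set
IsLittleOh-n f =
  ∀ (ε : ℚ) → 0ℚ ℚ.< ε →
  ∃ λ N → ∀ n .{{_ : NonZero n}} → n ≥ N → toℚ (f n) ℚ.≤ ε ℚ.* toℚ n

IsLeast : Pred ℕ 0ℓ → Pred ℕ 0ℓ
IsLeast P m = P m × (∀ k → P k → m ≤ k)

record Graph (V : Set) : Set₁ where
  field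
    Adj    : Rel V 0ℓ
    adj?   : Decidable Adj
    symm   : Symmetric Adj
    irrefl : Irreflexive _≡_ Adj

open Graph

TriangleFree : ∀ {V} → Graph V → Set
TriangleFree G = ∀ u v w → ¬ (Adj G u v × Adj G v w × Adj G u w)

Colourable : ∀ {V} → Graph V → ℕ → Set
Colourable {V} G k =
  Σ[ c ∈ (V → Fin k) ] (∀ u v → Adj G u v → c u ≢ c v)

IsChromaticNumber : ∀ {V} → Graph V → ℕ → Set
IsChromaticNumber G = IsLeast (Colourable G)

-- Finite graphs are taken on the vertex set Fin m.
order : ∀ {m} → Graph (Fin m) → ℕ
order {m} _ = m

neighbours : ∀ {m} → Graph (Fin m) → Fin m → Subset m
neighbours G v = tabulate (λ w → does (adj? G v w))

degree : ∀ {m} → Graph (Fin m) → Fin m → ℕ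
degree G v = ∣ neighbours G v ∣

IsMinimumDegree : ∀ {m} → Graph (Fin m) → ℕ → Set
IsMinimumDegree G = IsLeast (λ d → ∃ λ v → degree G v ≡ d)

-- Not necessarily induced.
record Subgraph {V : Set} (K : Graph V) : Set₁ where
  field
    has : V → Bool

  Vertex : Set
  Vertex = Σ[ v ∈ V ] T (has v)

  field
    graph : Graph Vertex
    ⊆-Adj : ∀ {u v} → Adj graph u v → Adj K (proj₁ u) (proj₁ v)

HasOrder : ∀ {V} {K : Graph V} → Subgraph K → ℕ → Set
HasOrder H m = Subgraph.Vertex H ↔ Fin m

KneserVertex : ℕ → ℕ → Set
KneserVertex n k = Σ[ s ∈ Subset (2 * n + k) ] ∣ s ∣ ≡ n

-- Positivity of n is what makes disjointness irreflexive.
KG : (n : ℕ) → .{{NonZero n}} → (k : ℕ) → Graph (KneserVertex n k)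
KG n k = record
  { Adj    = λ s t → Empty (proj₁ s ∩ proj₁ t)
  ; adj?   = λ s t → ¬? (nonempty? (proj₁ s ∩ proj₁ t))
  ; symm   = λ {s} {t} → subst Empty (∩-comm (proj₁ s) (proj₁ t))
  ; irrefl = λ { {s , ∣s∣≡n} refl disj → ≢-nonZero⁻¹ n (trans (sym ∣s∣≡n)
      (trans (cong ∣_∣ (Empty-unique (subst Empty (∩-idem s) disj)))
             (∣⊥∣≡0 (2 * n + k)))) }
  }

{-# OPTIONS --safe #-}

-- Hajnal's construction: take the ground set B of KG(n,k), join each vertex of
-- H, which is an n-subset of B, to its own elements, and join B completely to
-- n new vertices.  Disjointness of adjacent n-sets excludes triangles with an
-- element of B, and three pairwise disjoint n-sets do not fit into 2n + k
-- points once k < n.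

module Submission where

open import Defs
open import Data.Nat using (ℕ; _+_; _*_; _≤_; _≥_; _<_; NonZero)
open import Data.Integer using (+_)
open import Data.Rational as ℚ using (ℚ)
open import Data.Fin using (Fin)
open import Data.Product using (∃; _×_)
open import Relation.Binary.PropositionalEquality using (_≡_)

open import Data.Bool using (Bool; true)
open import Data.Empty using (⊥)
open import Data.Fin
  using (zero; suc; fromℕ<; splitAt; _↑ˡ_; _↑ʳ_; finToFun; funToFin; _≟_)
open import Data.Fin.Properties
  using (any?; all?; splitAt-↑ˡ; splitAt-↑ʳ; finToFun-funToFin)
open import Data.Fin.Subset as Subset
  using (Subset; inside; outside; _∈_; _∩_; _∪_; ∣_∣; Empty)
open import Data.Fin.Subset.Properties
  using (_∈?_; ∣p∣≤∣x∷p∣; p⊆q⇒∣p∣≤∣q∣; ∣⊤∣≡n; ∣p∣≤n; drop-∷-Empty;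
         x∈p∩q⁺; x∈p∩q⁻; x∈p∪q⁻)
import Data.Integer as ℤ
import Data.Integer.Properties as ℤ
open import Data.Nat as ℕ using (zero; suc; z≤n; s≤s)
open import Data.Nat.Properties
  using (≤-refl; ≤-trans; ≤-reflexive; <⇒≱; +-monoˡ-≤; +-cancelˡ-≤; +-suc; m≤m+n;
         module ≤-Reasoning)
open import Data.Nat.Solver using () renaming (module +-*-Solver to ℕ-Solver)
open import Data.Product using (_,_; proj₁; proj₂)
import Data.Rational.Properties as ℚ
open import Data.Rational.Solver using () renaming (module +-*-Solver to ℚ-Solver)
import Data.Rational.Unnormalised as ℚᵘ
import Data.Rational.Unnormalised.Properties as ℚᵘ
open import Data.Sum as Sum using (_⊎_; inj₁; inj₂; [_,_]′)
open import Data.Unit using (tt) renaming (⊤ to Unit)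
open import Data.Vec using (_∷_; []; here; tabulate)
open import Data.Vec.Properties using (lookup⇒[]=; lookup∘tabulate)
open import Function using (_∘_; id)
open import Function.Bundles using (_↔_; module Inverse)
open import Level using (0ℓ)
open import Relation.Binary.PropositionalEquality
  using (refl; sym; trans; cong; cong₂; subst; subst₂)
open import Relation.Nullary using (¬_; Dec; yes; no; does; contradiction)
open import Relation.Nullary.Decidable using (dec-true; map′; _→-dec_; ¬?)
open import Relation.Unary using (Pred; Decidable)

open Graph

-- Existence of chromatic numbers and minimum degrees

least-∃ : ∀ {P : Pred ℕ 0ℓ} → Decidable P → ∀ {b} → P b → ∃ (IsLeast P)
least-∃ P? {b} pb with P? 0
least-∃ P? {b}     pb | yes p0 = 0 , p0 , λ _ _ → z≤n
least-∃ P? {zero}  pb | no ¬p0 = contradiction pb ¬p0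
-- The search moves up by shifting the predicate, so the known witness `b` drops by one and bounds
-- it.
least-∃ P? {suc b} pb | no ¬p0 with least-∃ (P? ∘ suc) {b} pb
... | m , pm , least = suc m , pm , λ
  { zero    p0 → contradiction p0 ¬p0
  ; (suc k) pk → s≤s (least k pk) }

-- A colouring is coded by an element of `Fin (k ^ m)`, which makes the search finite. Decoding
-- returns the original colouring only pointwise, so properness is carried over value by value.
Colourable? : ∀ {m} (G : Graph (Fin m)) → Decidable (Colourable G)
Colourable? {m} G k = map′
  (λ (i , proper) → finToFun i , proper)
  (λ (c , proper) → funToFin c , λ u v uv cu≡cv → proper u v uv
    (trans (sym (finToFun-funToFin c u)) (trans cu≡cv (finToFun-funToFin c v))))
  (any? λ i → all? λ u → all? λ v →
    adj? G u v →-dec ¬? (finToFun {k} {m} i u ≟ finToFun i v))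

chromaticNumber : ∀ {m} (G : Graph (Fin m)) → ∃ (IsChromaticNumber G)
chromaticNumber {m} G =
  -- Giving each vertex its own colour is proper, so `m` bounds the search.
  least-∃ (Colourable? G) {m} (id , λ u v uv u≡v → irrefl G u≡v uv)

minimumDegree : ∀ {m} (G : Graph (Fin m)) → Fin m → ∃ (IsMinimumDegree G)
minimumDegree G v =
  least-∃ (λ d → any? λ u → degree G u ℕ.≟ d) (v , refl)

pullback : ∀ {V W : Set} → (V → W) → Graph W → Graph V
pullback φ G = record
  { Adj    = λ u v → Adj G (φ u) (φ v)
  ; adj?   = λ u v → adj? G (φ u) (φ v)
  ; symm   = symm G
  ; irrefl = irrefl G ∘ cong φ
  }

-- Cardinalities of subsets and of blocks of a row

∣tabulate-↑ˡ∣≤ : ∀ {m} n (f : Fin (m + n) → Bool) →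
                 ∣ tabulate (f ∘ (_↑ˡ n)) ∣ ≤ ∣ tabulate f ∣
∣tabulate-↑ˡ∣≤ {zero}  n f = z≤n
∣tabulate-↑ˡ∣≤ {suc m} n f with f zero
... | inside  = s≤s (∣tabulate-↑ˡ∣≤ n (f ∘ suc))
... | outside = ∣tabulate-↑ˡ∣≤ n (f ∘ suc)

∣tabulate-↑ʳ∣≤ : ∀ m {n} (f : Fin (m + n) → Bool) →
                 ∣ tabulate (f ∘ (m ↑ʳ_)) ∣ ≤ ∣ tabulate f ∣
∣tabulate-↑ʳ∣≤ zero    f = ≤-refl
∣tabulate-↑ʳ∣≤ (suc m) f =
  ≤-trans (∣tabulate-↑ʳ∣≤ m (f ∘ suc)) (∣p∣≤∣x∷p∣ (f zero) (tabulate (f ∘ suc)))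

∣p∣≤∣tabulate∣ : ∀ {m} (p : Subset m) (f : Fin m → Bool) →
                 (∀ i → i ∈ p → f i ≡ true) → ∣ p ∣ ≤ ∣ tabulate f ∣
∣p∣≤∣tabulate∣ p f p⊆f = p⊆q⇒∣p∣≤∣q∣ λ {i} i∈p →
  lookup⇒[]= i (tabulate f) (trans (lookup∘tabulate f i) (p⊆f i i∈p))

disjoint⇒∣p∣+∣q∣≤∣p∪q∣ : ∀ {m} (p q : Subset m) → Empty (p ∩ q) →
                         ∣ p ∣ + ∣ q ∣ ≤ ∣ p ∪ q ∣
disjoint⇒∣p∣+∣q∣≤∣p∪q∣ []            []            _ = z≤n
disjoint⇒∣p∣+∣q∣≤∣p∪q∣ (inside  ∷ p) (inside  ∷ q) e =
  contradiction (zero , here) e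
disjoint⇒∣p∣+∣q∣≤∣p∪q∣ (inside  ∷ p) (outside ∷ q) e =
  s≤s (disjoint⇒∣p∣+∣q∣≤∣p∪q∣ p q (drop-∷-Empty e))
disjoint⇒∣p∣+∣q∣≤∣p∪q∣ (outside ∷ p) (inside  ∷ q) e =
  ≤-trans (≤-reflexive (+-suc ∣ p ∣ ∣ q ∣))
          (s≤s (disjoint⇒∣p∣+∣q∣≤∣p∪q∣ p q (drop-∷-Empty e)))
disjoint⇒∣p∣+∣q∣≤∣p∪q∣ (outside ∷ p) (outside ∷ q) e =
  disjoint⇒∣p∣+∣q∣≤∣p∪q∣ p q (drop-∷-Empty e)

KG-triangleFree : ∀ n .{{_ : NonZero n}} {k} → k < n → TriangleFree (KG n k)
KG-triangleFree n {k} k<n (p , ∣p∣≡n) (q , ∣q∣≡n) (r , ∣r∣≡n) (pq , qr , pr) =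
  -- Three disjoint sets would give `3n ≤ 2n + k`; cancelling `2 * n` leaves `n ≤ k`.
  <⇒≱ k<n (+-cancelˡ-≤ (2 * n) n k (begin
    2 * n + n             ≡⟨ solve 1 (λ n → con 2 :* n :+ n := n :+ n :+ n) refl n ⟩
    n + n + n             ≡⟨ cong₂ _+_ (cong₂ _+_ ∣p∣≡n ∣q∣≡n) ∣r∣≡n ⟨
    ∣ p ∣ + ∣ q ∣ + ∣ r ∣ ≤⟨ +-monoˡ-≤ ∣ r ∣ (disjoint⇒∣p∣+∣q∣≤∣p∪q∣ p q pq) ⟩
    ∣ p ∪ q ∣ + ∣ r ∣     ≤⟨ disjoint⇒∣p∣+∣q∣≤∣p∪q∣ (p ∪ q) r p∪q#r ⟩
    ∣ (p ∪ q) ∪ r ∣       ≤⟨ ∣p∣≤n ((p ∪ q) ∪ r) ⟩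
    2 * n + k             ∎))
  where
  open ≤-Reasoning
  open ℕ-Solver
  p∪q#r : Empty ((p ∪ q) ∩ r)
  p∪q#r (x , x∈) with x∈p∩q⁻ (p ∪ q) r x∈
  ... | x∈p∪q , x∈r = [ (λ x∈p → pr (x , x∈p∩q⁺ (x∈p , x∈r)))
                      , (λ x∈q → qr (x , x∈p∩q⁺ (x∈q , x∈r))) ]′ (x∈p∪q⁻ p q x∈p∪q)

-- The Hajnal graph of a set-labelled graph

module _ {A : Set} (H : Graph A) {b : ℕ} (s : A → Subset b) (n : ℕ) where

  private
    V = A ⊎ (Fin b ⊎ Fin n)

    pattern left  a = inj₁ a
    pattern mid   x = inj₂ (inj₁ x)
    pattern right y = inj₂ (inj₂ y)

    Adjʰ : V → V → Set
    Adjʰ (left a)  (left a′) = Adj H a a′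
    Adjʰ (left a)  (mid x)   = x ∈ s a
    Adjʰ (mid x)   (left a)  = x ∈ s a
    Adjʰ (mid _)   (right _) = Unit
    Adjʰ (right _) (mid _)   = Unit
    Adjʰ (left _)  (right _) = ⊥
    Adjʰ (right _) (left _)  = ⊥
    Adjʰ (mid _)   (mid _)   = ⊥
    Adjʰ (right _) (right _) = ⊥

    adjʰ? : ∀ u v → Dec (Adjʰ u v)
    adjʰ? (left a)  (left a′) = adj? H a a′
    adjʰ? (left a)  (mid x)   = x ∈? s a
    adjʰ? (mid x)   (left a)  = x ∈? s a
    adjʰ? (mid _)   (right _) = yes tt
    adjʰ? (right _) (mid _)   = yes tt
    adjʰ? (left _)  (right _) = no id
    adjʰ? (right _) (left _)  = no id
    adjʰ? (mid _)   (mid _)   = no id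
    adjʰ? (right _) (right _) = no id

    symmʰ : ∀ u v → Adjʰ u v → Adjʰ v u
    symmʰ (left _)  (left _)  = symm H
    symmʰ (left _)  (mid _)   = id
    symmʰ (mid _)   (left _)  = id
    symmʰ (mid _)   (right _) = id
    symmʰ (right _) (mid _)   = id

    irreflʰ : ∀ u → ¬ Adjʰ u u
    irreflʰ (left _)  = irrefl H refl
    irreflʰ (mid _)   = id
    irreflʰ (right _) = id

  hajnal : Graph V
  hajnal = record
    { Adj    = Adjʰ
    ; adj?   = adjʰ?
    ; symm   = λ {u} {v} → symmʰ u v
    ; irrefl = λ { {u} refl → irreflʰ u }
    }

  -- Right vertices see only middle ones, and the middle is independent, so a triangle has no right
  -- vertex and at most one middle vertex `x`. If it has one, `x` lies in the labels of two adjacent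
  -- left vertices; the three such cases are the positions of `x`.
  hajnal-triangleFree : TriangleFree H →
                        (∀ {a a′} → Adj H a a′ → Empty (s a ∩ s a′)) →
                        TriangleFree hajnal
  hajnal-triangleFree △ disj = λ where
    (left a)  (left a′) (left a″) t               → △ a a′ a″ t
    (left _)  (left _)  (mid x)   (aa′ , ∈a′ , ∈a) → disj aa′ (x , x∈p∩q⁺ (∈a , ∈a′))
    (left _)  (mid x)   (left _)  (∈a , ∈a′ , aa′) → disj aa′ (x , x∈p∩q⁺ (∈a , ∈a′))
    (mid x)   (left _)  (left _)  (∈a , aa′ , ∈a′) → disj aa′ (x , x∈p∩q⁺ (∈a , ∈a′))
    (left _)  (mid _)   (mid _)   (_ , () , _)
    (left _)  (mid _)   (right _) (_ , _ , ())
    (mid _)   (left _)  (mid _)   (_ , _ , ())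
    (mid _)   (right _) (mid _)   (_ , _ , ())
    (mid _)   (right _) (left _)  (_ , () , _)
    (mid _)   (right _) (right _) (_ , () , _)
    (right _) (mid _)   (left _)  (_ , _ , ())
    (right _) (mid _)   (mid _)   (_ , () , _)
    (right _) (mid _)   (right _) (_ , _ , ())

  -- Transfer to `Fin` and degree bounds

  module _ {k : ℕ} (A↔ : A ↔ Fin k) where
    open Inverse A↔

    private
      -- Reads the index set as three consecutive blocks of lengths `k`, `b` and `n`, for left,
      -- middle and right.
      φ : Fin (k + (b + n)) → V
      φ i = Sum.map from (splitAt b) (splitAt k i)

      φ-left : ∀ a → φ (to a ↑ˡ (b + n)) ≡ left a
      φ-left a rewrite splitAt-↑ˡ k (to a) (b + n) = cong inj₁ (strictlyInverseʳ a)

      φ-mid : ∀ x → φ (k ↑ʳ (x ↑ˡ n)) ≡ mid x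
      φ-mid x rewrite splitAt-↑ʳ k (b + n) (x ↑ˡ n) | splitAt-↑ˡ b x n = refl

      φ-right : ∀ y → φ (k ↑ʳ (b ↑ʳ y)) ≡ right y
      φ-right y rewrite splitAt-↑ʳ k (b + n) (b ↑ʳ y) | splitAt-↑ʳ b n y = refl

    hajnalFin : Graph (Fin (k + (b + n)))
    hajnalFin = pullback φ hajnal

    hajnalFin-triangleFree : TriangleFree hajnal → TriangleFree hajnalFin
    hajnalFin-triangleFree △ u v w = △ (φ u) (φ v) (φ w)

    private
      adjacent : ∀ u v {w} → φ v ≡ w → Adjʰ (φ u) w →
                 does (adj? hajnalFin u v) ≡ true
      adjacent u v refl = dec-true (adj? hajnalFin u v)

      -- Only the middle block of the adjacency row of `v` is counted; dropping the other blocks can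
      -- only lower the count.
      mids : ∀ v (p : Subset b) → (∀ x → x ∈ p → Adjʰ (φ v) (mid x)) →
             ∣ p ∣ ≤ degree hajnalFin v
      mids v p h = begin
        ∣ p ∣                             ≤⟨ ∣p∣≤∣tabulate∣ p (row ∘ (k ↑ʳ_) ∘ (_↑ˡ n))
                                               (λ x x∈p → adjacent v _ (φ-mid x) (h x x∈p)) ⟩
        ∣ tabulate (row ∘ (k ↑ʳ_) ∘ (_↑ˡ n)) ∣ ≤⟨ ∣tabulate-↑ˡ∣≤ n (row ∘ (k ↑ʳ_)) ⟩
        ∣ tabulate (row ∘ (k ↑ʳ_)) ∣      ≤⟨ ∣tabulate-↑ʳ∣≤ k row ⟩
        ∣ tabulate row ∣                  ∎
        where
        open ≤-Reasoning
        row = λ w → does (adj? hajnalFin v w)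

      rights : ∀ v → (∀ y → Adjʰ (φ v) (right y)) → n ≤ degree hajnalFin v
      rights v h = begin
        n                                 ≡⟨ ∣⊤∣≡n n ⟨
        ∣ Subset.⊤ {n} ∣                  ≤⟨ ∣p∣≤∣tabulate∣ Subset.⊤ (row ∘ (k ↑ʳ_) ∘ (b ↑ʳ_))
                                               (λ y _ → adjacent v _ (φ-right y) (h y)) ⟩
        ∣ tabulate (row ∘ (k ↑ʳ_) ∘ (b ↑ʳ_)) ∣ ≤⟨ ∣tabulate-↑ʳ∣≤ b (row ∘ (k ↑ʳ_)) ⟩
        ∣ tabulate (row ∘ (k ↑ʳ_)) ∣      ≤⟨ ∣tabulate-↑ʳ∣≤ k row ⟩
        ∣ tabulate row ∣                  ∎
        where
        open ≤-Reasoning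
        row = λ w → does (adj? hajnalFin v w)

    -- One block suffices for each kind of vertex: a left one sees the elements of its label, a
    -- middle one all `n` right vertices, a right one all `b` middle vertices.
    hajnalFin-degree : (∀ a → n ≤ ∣ s a ∣) → n ≤ b → ∀ v → n ≤ degree hajnalFin v
    hajnalFin-degree n≤∣s∣ n≤b v = by-kind (φ v) refl
      where
      -- Keeping the equation lets the kind be split while the degree still speaks of `v`.
      by-kind : ∀ w → φ v ≡ w → n ≤ degree hajnalFin v
      by-kind (left a)  eq = ≤-trans (n≤∣s∣ a)
        (mids v (s a) λ x x∈sa → subst (λ w → Adjʰ w (mid x)) (sym eq) x∈sa)
      by-kind (mid x)   eq =
        rights v λ y → subst (λ w → Adjʰ w (right y)) (sym eq) tt
      by-kind (right y) eq = ≤-trans (≤-trans n≤b (≤-reflexive (sym (∣⊤∣≡n b))))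
        (mids v Subset.⊤ λ x _ → subst (λ w → Adjʰ w (mid x)) (sym eq) tt)

    -- `H` is the left block, so colourings restrict to it.
    hajnalFin-colourable : ∀ {c} → Colourable hajnalFin c → Colourable H c
    hajnalFin-colourable (col , proper) =
      col ∘ (_↑ˡ (b + n)) ∘ to ,
      λ a a′ aa′ → proper _ _ (subst₂ Adjʰ (sym (φ-left a)) (sym (φ-left a′)) aa′)

-- The construction applied to a Kneser subgraph

module _ (n : ℕ) .{{_ : NonZero n}} {k : ℕ} (k<n : k < n) (H : Subgraph (KG n k))
         (H↔ : HasOrder H k) (0<k : 0 < k) where

  open Subgraph H renaming (graph to Hᴳ)

  -- The order is an arbitrary m, so that G can live on Fin (3 * n + 2 * k)
  -- without a transport.
  kneserHajnal : ∀ {m} → m ≡ k + ((2 * n + k) + n) →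
    ∃ λ (G : Graph (Fin m)) →
      TriangleFree G
      × (∃ λ δ → IsMinimumDegree G δ × n ≤ δ)
      × (∀ {c} → Colourable G c → Colourable Hᴳ c)
  kneserHajnal refl = G , triangleFree , minDegree , hajnalFin-colourable Hᴳ s n H↔
    where
    s : Vertex → Subset (2 * n + k)
    s = proj₁ ∘ proj₁

    G = hajnalFin Hᴳ s n H↔

    triangleFree : TriangleFree G
    triangleFree = hajnalFin-triangleFree Hᴳ s n H↔ (hajnal-triangleFree Hᴳ s n
      (λ a a′ a″ (p , q , r) → KG-triangleFree n k<n (proj₁ a) (proj₁ a′) (proj₁ a″)
                                 (⊆-Adj p , ⊆-Adj q , ⊆-Adj r))
      ⊆-Adj)

    minDegree : ∃ λ δ → IsMinimumDegree G δ × n ≤ δ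
    -- Since `0 < k`, the left block has a first vertex, so the set of degrees is inhabited.
    minDegree with minimumDegree G (fromℕ< 0<k ↑ˡ (2 * n + k + n))
    ... | δ , isMin@((v , refl) , _) = δ , isMin ,
      hajnalFin-degree Hᴳ s n H↔ (λ a → ≤-reflexive (sym (proj₂ (proj₁ a))))
        -- The middle block is large enough: `n ≤ 2 * n ≤ 2 * n + k`, where `2 * n` unfolds to
        -- `n + (n + 0)`.
        (≤-trans (m≤m+n n (n + 0)) (m≤m+n (2 * n) k)) v

-- Arithmetic of naturals inside the rationals

toℚᵘ-toℚ : ∀ m → ℚ.toℚᵘ (toℚ m) ℚᵘ.≃ ℚᵘ.mkℚᵘ (+ m) 0
toℚᵘ-toℚ m = ℚ.toℚᵘ-fromℚᵘ (ℚᵘ.mkℚᵘ (+ m) 0)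

-- Reduction to lowest terms is stuck on variables, so the sum is computed on unnormalised
-- fractions; the `0` in `mkℚᵘ` is the denominator minus one.
toℚ-homo-+ : ∀ m n → toℚ (m + n) ≡ toℚ m ℚ.+ toℚ n
toℚ-homo-+ m n = ℚ.toℚᵘ-injective (begin
  ℚ.toℚᵘ (toℚ (m + n))                          ≈⟨ toℚᵘ-toℚ (m + n) ⟩
  ℚᵘ.mkℚᵘ (+ (m + n)) 0                         ≡⟨ cong (λ i → ℚᵘ.mkℚᵘ i 0)
                                                    (cong₂ ℤ._+_ (ℤ.*-identityʳ (+ m)) (ℤ.*-identityʳ (+ n))) ⟨
  ℚᵘ.mkℚᵘ (+ m) 0 ℚᵘ.+ ℚᵘ.mkℚᵘ (+ n) 0         ≈⟨ ℚᵘ.+-cong (toℚᵘ-toℚ m) (toℚᵘ-toℚ n) ⟨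
  ℚ.toℚᵘ (toℚ m) ℚᵘ.+ ℚ.toℚᵘ (toℚ n)           ≈⟨ ℚ.toℚᵘ-homo-+ (toℚ m) (toℚ n) ⟨
  ℚ.toℚᵘ (toℚ m ℚ.+ toℚ n)                     ∎)
  where open import Relation.Binary.Reasoning.Setoid ℚᵘ.≃-setoid

toℚ-homo-* : ∀ m n → toℚ (m * n) ≡ toℚ m ℚ.* toℚ n
toℚ-homo-* m n = ℚ.toℚᵘ-injective (begin
  ℚ.toℚᵘ (toℚ (m * n))                          ≈⟨ toℚᵘ-toℚ (m * n) ⟩
  ℚᵘ.mkℚᵘ (+ (m * n)) 0                         ≡⟨ cong (λ i → ℚᵘ.mkℚᵘ i 0) (ℤ.pos-* m n) ⟩
  ℚᵘ.mkℚᵘ (+ m) 0 ℚᵘ.* ℚᵘ.mkℚᵘ (+ n) 0         ≈⟨ ℚᵘ.*-cong (toℚᵘ-toℚ m) (toℚᵘ-toℚ n) ⟨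
  ℚ.toℚᵘ (toℚ m) ℚᵘ.* ℚ.toℚᵘ (toℚ n)           ≈⟨ ℚ.toℚᵘ-homo-* (toℚ m) (toℚ n) ⟨
  ℚ.toℚᵘ (toℚ m ℚ.* toℚ n)                     ∎)
  where open import Relation.Binary.Reasoning.Setoid ℚᵘ.≃-setoid

toℚ-cancel-< : ∀ {m n} → toℚ m ℚ.< toℚ n → m < n
toℚ-cancel-< {m} {n} m<n
  with ℚᵘ.<-respˡ-≃ (toℚᵘ-toℚ m) (ℚᵘ.<-respʳ-≃ (toℚᵘ-toℚ n) (ℚ.toℚᵘ-mono-< m<n))
... | ℚᵘ.*<* m*1<n*1 =
  ℤ.drop‿+<+ (subst₂ ℤ._<_ (ℤ.*-identityʳ (+ m)) (ℤ.*-identityʳ (+ n)) m*1<n*1)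

m≤½n⇒m<n : ∀ {m} n .{{_ : NonZero n}} → toℚ m ℚ.≤ ℚ.½ ℚ.* toℚ n → m < n
m≤½n⇒m<n {m} n m≤½n = toℚ-cancel-< (begin-strict
  toℚ m              ≤⟨ m≤½n ⟩
  -- Strict because `n` is nonzero.
  ℚ.½ ℚ.* toℚ n      <⟨ ℚ.*-monoˡ-<-pos (toℚ n) {{ℚ.normalize-pos n 1}} ½<1 ⟩
  ℚ.1ℚ ℚ.* toℚ n     ≡⟨ ℚ.*-identityˡ (toℚ n) ⟩
  toℚ n              ∎)
  where
  open ℚ.≤-Reasoning
  ½<1 : ℚ.½ ℚ.< ℚ.1ℚ
  ½<1 = ℚ.*<* (ℤ.+<+ (s≤s (s≤s z≤n)))

n≡⅓[3n+2k]-⅔k : ∀ n k →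
  toℚ n ≡ (+ 1 ℚ./ 3) ℚ.* toℚ (3 * n + 2 * k) ℚ.- (+ 2 ℚ./ 3) ℚ.* toℚ k
n≡⅓[3n+2k]-⅔k n k
  -- Afterwards `toℚ n` and `toℚ k` are the only atoms of a linear identity.
  rewrite toℚ-homo-+ (3 * n) (2 * k) | toℚ-homo-* 3 n | toℚ-homo-* 2 k =
  solve 2 (λ x y → x := con (+ 1 ℚ./ 3) :* (con (toℚ 3) :* x :+ con (toℚ 2) :* y)
                          :- con (+ 2 ℚ./ 3) :* y) refl (toℚ n) (toℚ k)
  where open ℚ-Solver

theorem3p1 : (f : ℕ⁺→ℕ) →
    (∀ n .{{_ : NonZero n}} → 0 < f n) →
    IsLittleOh-n f →
    ∃ λ N → ∀ n .{{_ : NonZero n}} → n ≥ N → ∀ (t : ℕ) →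
    (∃ λ (H : Subgraph (KG n (f n))) →
    HasOrder H (f n)
    × (∃ λ χ → IsChromaticNumber (Subgraph.graph H) χ × t ≤ χ)) →
    ∃ λ (G : Graph (Fin (3 * n + 2 * f n))) →
    TriangleFree G
    × (∃ λ δ → IsMinimumDegree G δ × n ≤ δ)
    × (toℚ n ≡ (+ 1 ℚ./ 3) ℚ.* toℚ (order G) ℚ.- (+ 2 ℚ./ 3) ℚ.* toℚ (f n))
    × (∃ λ χ → IsChromaticNumber G χ × t ≤ χ)
-- Taking `ε = ½` gives `f n ≤ n / 2 < n` from `N` on, which is the bound that rules out triangles
-- in the Kneser graph.
theorem3p1 f f>0 f=o[n] with f=o[n] ℚ.½ (ℚ.*<* (ℤ.+<+ (s≤s z≤n)))
... | N , f≤½n = N , λ n n≥N t (H , H↔ , χᴴ , (_ , χᴴ-least) , t≤χᴴ) →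
  let G , △ , δ , colH = kneserHajnal n (m≤½n⇒m<n n (f≤½n n n≥N)) H H↔ (f>0 n)
                           (order≡ n (f n))
      χ , isχ@(col , _) = chromaticNumber G
  in G , △ , δ , n≡⅓[3n+2k]-⅔k n (f n) ,
     -- An optimal colouring of `G` restricts to `H`, hence `t ≤ χᴴ ≤ χ`.
     χ , isχ , ≤-trans t≤χᴴ (χᴴ-least χ (colH col))
  where
  open ℕ-Solver
  order≡ : ∀ n k → 3 * n + 2 * k ≡ k + ((2 * n + k) + n)
  order≡ = solve 2 (λ n k → con 3 :* n :+ con 2 :* k := k :+ ((con 2 :* n :+ k) :+ n)) refl
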